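{- There exist $M\in\mathbb{N}$ and a nonempty set $A\subset\mathbb{Z}_M$ such that $A$ satisfies (T1), $M$ has two distinct prime divisors, and $A(X)$ has at least one unsupported cyclotomic divisor.
   Context: $\mathbb{Z}_M=\mathbb{Z}/M\mathbb{Z}$. For $A\subset\mathbb{Z}_M$, represent its elements by integers in $\{0,1,\dots,M-1\}$; the mask polynomial is $A(X)=\sum_{a\in A}X^a$, considered modulo $X^M-1$. For $s\mid M$, divisibility of $A(X)$ by the $s$-th cyclotomic polynomial $\Phi_s(X)$ is well defined, since $\Phi_s\mid X^M-1$; all cyclotomic divisors $\Phi_s$ considered have $s\mid M$. "$M$ has two distinct prime divisors" means exactly two. $S_A^*$ is the set of all prime powers $p^\alpha>1$ (with $p^\alpha\mid M$) such that $\Phi_{p^\alpha}(X)\mid A(X)$. Condition (T1): $|A|=\prod_{s\in S_A^*}\Phi_s(1)$. If $s\neq1$ and $\Phi_s\mid A$, then $\Phi_s$ is called an unsupported divisor of $A$ if (i) for every prime $p\mid s$ we have $p\mid |A|$, and (ii) for every prime power $p^\alpha$ with $p^\alpha\parallel s$ (i.e. $p$ is a prime dividing $s$, $p^\alpha\mid s$ and $p^{\alpha+1}\nmid s$), we have $\Phi_{p^\alpha}\nmid A$. -}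

module Defs where

open import Data.Bool using (if_then_else_)
open import Data.Fin using (toℕ)
open import Data.Fin.Properties using (toℕ<n)
open import Data.Fin.Subset using (Subset) renaming (∣_∣ to card)
open import Data.Integer using (ℤ; +_; 0ℤ; 1ℤ; -1ℤ) renaming (_+_ to _+ᶻ_; _*_ to _*ᶻ_)
open import Data.List using (List; []; _∷_; map; foldr; length; take; allFin)
open import Data.List.Membership.Propositional using (_∈_)
open import Data.List.Relation.Unary.Unique.Propositional using (Unique)
open import Data.Nat using (ℕ; zero; suc; _∸_; _^_; _≤_)
open import Data.Nat.Divisibility using (_∣_; _∣?_)
open import Data.Nat.Induction using (<-rec)
open import Data.Nat.Primality using (Prime)
open import Data.Product using (_×_; _,_; ∃-syntax; proj₁)
open import Data.Sum using (_⊎_)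
import Data.Vec as Vec
open import Function.Bundles using (_⇔_)
open import Relation.Binary.PropositionalEquality using (_≡_; _≢_)
open import Relation.Nullary using (¬_; does)

-- Polynomials in ℤ[X] as coefficient lists, constant term first.  Trailing
-- zeros are allowed, so equality of polynomials is _≈_, not _≡_.

Poly : Set
Poly = List ℤ

coeff : Poly → ℕ → ℤ
coeff []      _       = 0ℤ
coeff (a ∷ f) zero    = a
coeff (a ∷ f) (suc n) = coeff f n

infix 4 _≈_ _∣ₚ_
infixl 6 _⊕_ _⊖_
infixl 7 _⊗_ _·_

_≈_ : Poly → Poly → Set
f ≈ g = ∀ n → coeff f n ≡ coeff g n

_⊕_ : Poly → Poly → Poly
[]      ⊕ g       = g
(a ∷ f) ⊕ []      = a ∷ f
(a ∷ f) ⊕ (b ∷ g) = (a +ᶻ b) ∷ (f ⊕ g)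

_·_ : ℤ → Poly → Poly
c · f = map (c *ᶻ_) f

_⊖_ : Poly → Poly → Poly
f ⊖ g = f ⊕ -1ℤ · g

_⊗_ : Poly → Poly → Poly
[]      ⊗ g = []
(a ∷ f) ⊗ g = a · g ⊕ (0ℤ ∷ (f ⊗ g))

one : Poly
one = 1ℤ ∷ []

X^_ : ℕ → Poly
X^ zero  = one
X^ suc n = 0ℤ ∷ (X^ n)

eval : Poly → ℤ → ℤ
eval []      x = 0ℤ
eval (a ∷ f) x = a +ᶻ x *ᶻ eval f x

_∣ₚ_ : Poly → Poly → Set
g ∣ₚ f = ∃[ q ] (q ⊗ g ≈ f)

-- Like _∷_, but does not create a trailing zero.
_∷ₜ_ : ℤ → Poly → Poly
(+ 0) ∷ₜ []      = []
a     ∷ₜ []      = a ∷ []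
a     ∷ₜ (b ∷ f) = a ∷ b ∷ f

-- Quotient and remainder of f by g, meaningful when g is monic and its list
-- has no trailing zero, so that deg g = length g ∸ 1.  If f₀ = q₀ g + r₀ and
-- c is the coefficient of X^(deg g) in a + X r₀, then
-- a + X f₀ = (c + X q₀) g + (a + X r₀ - c g); the last bracket has degree
-- < deg g, so `take` discards zeros only.
quotRem : Poly → Poly → Poly × Poly
quotRem []      g = [] , []
quotRem (a ∷ f) g with quotRem f g
... | q₀ , r₀ = c ∷ₜ q₀ , take d ((a ∷ r₀) ⊖ c · g)
  where
  d = length g ∸ 1
  c = coeff (a ∷ r₀) d

quot : Poly → Poly → Poly
quot f g = proj₁ (quotRem f g)

-- The cyclotomic polynomials, by the recursion coming from
-- X^n - 1 = ∏_{d ∣ n} Φ_d: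
--   Φ_n = (X^n - 1) / ∏_{d ∣ n, d < n} Φ_d   (an exact division, n ≥ 1).
-- Φ 0 is a junk value.  For n ≥ 1 the index d = 0 contributes nothing to the
-- product, as 0 ∤ n.
Φ : ℕ → Poly
Φ = <-rec (λ _ → Poly) λ n rec →
  quot (X^ n ⊖ one)
       (foldr (λ d h → if does (toℕ d ∣? n) then rec (toℕ<n d) ⊗ h else h)
              one (allFin n))

-- A subset of ℤ_M is a Subset M, the residue classes being represented by
-- 0, …, M - 1.
mask : ∀ {M} → Subset M → Poly
mask A = Vec.toList (Vec.map (λ b → if b then 1ℤ else 0ℤ) A)

IsPrimePower : ℕ → Set
IsPrimePower s = ∃[ p ] ∃[ α ] (Prime p × 1 ≤ α × s ≡ p ^ α)

_∈S*_ : ∀ {M} → ℕ → Subset M → Set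
_∈S*_ {M} s A = IsPrimePower s × s ∣ M × Φ s ∣ₚ mask A

-- The finite set S_A^* is presented by a duplicate-free list of its elements;
-- the product does not depend on the choice of the list.
T1 : ∀ {M} → Subset M → Set
T1 A = ∃[ S ] (Unique S × (∀ s → s ∈ S ⇔ s ∈S* A) ×
               + card A ≡ foldr (λ s x → eval (Φ s) 1ℤ *ᶻ x) 1ℤ S)

ExactlyTwoPrimeDivisors : ℕ → Set
ExactlyTwoPrimeDivisors M =
  ∃[ p ] ∃[ q ] (Prime p × Prime q × p ≢ q × p ∣ M × q ∣ M ×
                 (∀ r → Prime r → r ∣ M → r ≡ p ⊎ r ≡ q))

record UnsupportedDivisor {M} (A : Subset M) (s : ℕ) : Set where
  field
    s∣M          : s ∣ M
    s≢1          : s ≢ 1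
    Φₛ∣A         : Φ s ∣ₚ mask A
    primes-∣-card : ∀ p → Prime p → p ∣ s → p ∣ card A
    Φ-∤A         : ∀ p α → Prime p → p ∣ s → p ^ α ∣ s → ¬ (p ^ suc α ∣ s) →
                   ¬ (Φ (p ^ α) ∣ₚ mask A)

{-# OPTIONS --safe #-}
-- Write ℤ₄₃₂ = ℤ₁₆ × ℤ₂₇ and let A have 72 elements.  The divisors Φ₄, Φ₈, Φ₁₆
-- say that A mod 16 is constant on the even and on the odd classes, and Φ₉, Φ₂₇
-- say that A mod 27 is constant on each class mod 3; as 72 = 2³ · 3², (T1) holds
-- if in addition Φ₂, Φ₃ ∤ A.  Now Φ₆ ∣ A means that the 2 × 3 table of A mod 6,
-- rows indexed mod 2 and columns mod 3, has the form xᵢ + yⱼ.  The table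
--    5  5 14
--   13 13 22
-- is of this form, its row sums 24 ≠ 48 are multiples of 8 (the number of
-- classes mod 16 of given parity), and its column sums 18, 18, 36 are multiples
-- of 9 that are not all equal.  So Φ₆ is an unsupported divisor of any A that
-- realises this table with marginals 3, 6 mod 16 and 2, 2, 4 mod 27.  That
-- Φ₂, Φ₃ ∤ A is seen by evaluating at X = 4.
module Submission where

open import Defs
open import Data.Fin using (toℕ)
open import Data.Fin.Subset using (Subset; Nonempty)
open import Data.Fin.Subset.Properties using (nonempty?)
open import Data.Integer using (+_; 0ℤ) renaming (_+_ to _+ᶻ_; _*_ to _*ᶻ_)
open import Data.Integer.Divisibility.Signed using (divides) renaming (_∣_ to _∣ᶻ_; _∣?_ to _∣ᶻ?_)
open import Data.Integer.Properties using (*-zeroʳ)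
open import Data.Integer.Tactic.RingSolver using (solve-∀)
open import Data.List using (List; []; _∷_)
open import Data.List.Membership.Propositional using (_∈_)
open import Data.List.Relation.Unary.All using (All; []; _∷_; lookup)
open import Data.List.Relation.Unary.Any using (here; there)
open import Data.Nat using (ℕ; zero; suc; _*_; _^_; _≤_; _<_; z≤n; s≤s; _≟_)
open import Data.Nat.Divisibility using (_∣_; _∣?_; ∣-trans; ∣1⇒≡1; m∣m*n)
open import Data.Nat.Primality
  using (Prime; prime?; prime[2]; euclidsLemma; prime⇒irreducible; ¬prime[1])
open import Data.Nat.Properties using (≰⇒>; ^-distribˡ-+-*; m+[n∸m]≡n; *-identityʳ)
open import Data.Product using (_×_; _,_; ∃)
open import Data.Sum using (_⊎_; inj₁; inj₂)
open import Data.Vec using (tabulate)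
open import Function.Bundles using (mk⇔)
open import Relation.Binary.PropositionalEquality
  using (_≡_; refl; sym; trans; cong; cong₂; subst; module ≡-Reasoning)
open import Relation.Nullary using (¬_; does; contradiction)
open import Relation.Nullary.Decidable using (from-yes; from-no; False; toWitnessFalse)
import Data.List.Membership.DecPropositional as DecMembership
import Data.List.Relation.Unary.Unique.DecPropositional as DecUnique

open ≡-Reasoning

-- Serves `eval-cong`: lists related by `≈` may differ in length, and the surplus tail consists of
-- zeros.
eval-cong-0 : ∀ f x → f ≈ [] → eval f x ≡ 0ℤ
eval-cong-0 []      x f≈[] = refl
eval-cong-0 (a ∷ f) x f≈[] = begin
  a +ᶻ x *ᶻ eval f x  ≡⟨ cong₂ (λ b y → b +ᶻ x *ᶻ y) (f≈[] 0) (eval-cong-0 f x λ n → f≈[] (suc n)) ⟩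
  0ℤ +ᶻ x *ᶻ 0ℤ       ≡⟨ cong (0ℤ +ᶻ_) (*-zeroʳ x) ⟩
  0ℤ                  ∎

eval-cong : ∀ f g x → f ≈ g → eval f x ≡ eval g x
eval-cong []      g       x f≈g = sym (eval-cong-0 g x λ n → sym (f≈g n))
eval-cong (a ∷ f) []      x f≈g = eval-cong-0 (a ∷ f) x f≈g
eval-cong (a ∷ f) (b ∷ g) x f≈g =
  cong₂ (λ c y → c +ᶻ x *ᶻ y) (f≈g 0) (eval-cong f g x λ n → f≈g (suc n))

eval-⊕ : ∀ f g x → eval (f ⊕ g) x ≡ eval f x +ᶻ eval g x
eval-⊕ []      g       x = lemma (eval g x)
  where
  lemma : ∀ y → y ≡ 0ℤ +ᶻ y
  lemma = solve-∀
eval-⊕ (a ∷ f) []      x = lemma (a +ᶻ x *ᶻ eval f x)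
  where
  lemma : ∀ y → y ≡ y +ᶻ 0ℤ
  lemma = solve-∀
eval-⊕ (a ∷ f) (b ∷ g) x =
  trans (cong (λ y → a +ᶻ b +ᶻ x *ᶻ y) (eval-⊕ f g x)) (lemma a b x (eval f x) (eval g x))
  where
  lemma : ∀ a b x y z → a +ᶻ b +ᶻ x *ᶻ (y +ᶻ z) ≡ (a +ᶻ x *ᶻ y) +ᶻ (b +ᶻ x *ᶻ z)
  lemma = solve-∀

eval-· : ∀ c f x → eval (c · f) x ≡ c *ᶻ eval f x
eval-· c []      x = sym (*-zeroʳ c)
eval-· c (a ∷ f) x =
  trans (cong (λ y → c *ᶻ a +ᶻ x *ᶻ y) (eval-· c f x)) (lemma c a x (eval f x))
  where
  lemma : ∀ c a x y → c *ᶻ a +ᶻ x *ᶻ (c *ᶻ y) ≡ c *ᶻ (a +ᶻ x *ᶻ y)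
  lemma = solve-∀

eval-⊗ : ∀ f g x → eval (f ⊗ g) x ≡ eval f x *ᶻ eval g x
eval-⊗ []      g x = refl
eval-⊗ (a ∷ f) g x = begin
  eval (a · g ⊕ (0ℤ ∷ f ⊗ g)) x
    ≡⟨ eval-⊕ (a · g) (0ℤ ∷ f ⊗ g) x ⟩
  eval (a · g) x +ᶻ (0ℤ +ᶻ x *ᶻ eval (f ⊗ g) x)
    ≡⟨ cong₂ (λ y z → y +ᶻ (0ℤ +ᶻ x *ᶻ z)) (eval-· a g x) (eval-⊗ f g x) ⟩
  a *ᶻ eval g x +ᶻ (0ℤ +ᶻ x *ᶻ (eval f x *ᶻ eval g x))
    ≡⟨ lemma a x (eval f x) (eval g x) ⟩
  (a +ᶻ x *ᶻ eval f x) *ᶻ eval g x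
    ∎
  where
  lemma : ∀ a x y z → a *ᶻ z +ᶻ (0ℤ +ᶻ x *ᶻ (y *ᶻ z)) ≡ (a +ᶻ x *ᶻ y) *ᶻ z
  lemma = solve-∀

-- Reduces refuting a polynomial divisibility to refuting one between two integers, which is
-- decidable.
∣ₚ⇒eval-∣ : ∀ f g x → g ∣ₚ f → eval g x ∣ᶻ eval f x
∣ₚ⇒eval-∣ f g x (q , q⊗g≈f) =
  divides (eval q x) (trans (sym (eval-cong (q ⊗ g) f x q⊗g≈f)) (eval-⊗ q g x))

-- Multiplying back certifies the quotient; with `≡` on lists the hypothesis can be checked by
-- `refl`.
exact-quot⇒∣ₚ : ∀ f g → quot f g ⊗ g ≡ f → g ∣ₚ f
exact-quot⇒∣ₚ f g eq = quot f g , λ n → cong (λ h → coeff h n) eq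

prime-∣-^⇒≡ : ∀ {p q} k → Prime p → Prime q → p ∣ q ^ k → p ≡ q
prime-∣-^⇒≡ zero pp pq p∣1 = contradiction (subst Prime (∣1⇒≡1 p∣1) pp) ¬prime[1]
prime-∣-^⇒≡ {p} {q} (suc k) pp pq p∣qᵏ⁺¹ with euclidsLemma q (q ^ k) pp p∣qᵏ⁺¹
... | inj₂ p∣qᵏ = prime-∣-^⇒≡ k pp pq p∣qᵏ
... | inj₁ p∣q with prime⇒irreducible pq p∣q
...   | inj₁ refl = contradiction pp ¬prime[1]
...   | inj₂ p≡q  = p≡q

exponent-< : ∀ p k {m α} → p ^ α ∣ m → ¬ p ^ k ∣ m → α < k
exponent-< p k {m} {α} pᵅ∣m pᵏ∤m = ≰⇒> λ k≤α → pᵏ∤m (∣-trans (pᵏ∣pᵅ k≤α) pᵅ∣m)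
  where
  pᵏ∣pᵅ : k ≤ α → p ^ k ∣ p ^ α
  pᵏ∣pᵅ k≤α = subst (λ e → p ^ k ∣ p ^ e) (m+[n∸m]≡n k≤α)
    (subst (p ^ k ∣_) (sym (^-distribˡ-+-* p k _)) (m∣m*n _))

prime[3] : Prime 3
prime[3] = from-yes (prime? 3)

prime-∣-2ᵃ*3ᵇ : ∀ a b {p} → Prime p → p ∣ 2 ^ a * 3 ^ b → p ≡ 2 ⊎ p ≡ 3
prime-∣-2ᵃ*3ᵇ a b pp p∣ with euclidsLemma (2 ^ a) (3 ^ b) pp p∣
... | inj₁ p∣2ᵃ = inj₁ (prime-∣-^⇒≡ a pp prime[2] p∣2ᵃ)
... | inj₂ p∣3ᵇ = inj₂ (prime-∣-^⇒≡ b pp prime[3] p∣3ᵇ)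

M : ℕ
M = 2 ^ 4 * 3 ^ 3

-- Translated so as to contain 431: the list mask A then has no trailing zeros,
-- hence an exact multiple q ⊗ Φ s equals it on the nose.
residues : List ℕ
residues =
  0 ∷ 9 ∷ 10 ∷ 17 ∷ 21 ∷ 25 ∷ 33 ∷ 34 ∷ 47 ∷ 51 ∷ 57 ∷ 58 ∷ 67 ∷ 68 ∷ 74 ∷ 77 ∷
  81 ∷ 82 ∷ 91 ∷ 92 ∷ 107 ∷ 115 ∷ 116 ∷ 123 ∷ 139 ∷ 140 ∷ 149 ∷ 152 ∷ 153 ∷
  163 ∷ 164 ∷ 173 ∷ 179 ∷ 183 ∷ 197 ∷ 205 ∷ 209 ∷ 213 ∷ 221 ∷ 230 ∷ 235 ∷ 239 ∷
  245 ∷ 254 ∷ 265 ∷ 269 ∷ 278 ∷ 295 ∷ 302 ∷ 311 ∷ 326 ∷ 335 ∷ 336 ∷ 341 ∷ 350 ∷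
  359 ∷ 360 ∷ 367 ∷ 371 ∷ 383 ∷ 384 ∷ 393 ∷ 397 ∷ 401 ∷ 407 ∷ 408 ∷ 417 ∷ 418 ∷
  423 ∷ 427 ∷ 428 ∷ 431 ∷ []

A : Subset M
A = tabulate λ i → does (toℕ i ∈? residues)
  where open DecMembership _≟_ using (_∈?_)

S : List ℕ
S = 4 ∷ 8 ∷ 16 ∷ 9 ∷ 27 ∷ []

Φ∤A : ∀ s x → {False (eval (Φ s) x ∣ᶻ? eval (mask A) x)} → ¬ Φ s ∣ₚ mask A
Φ∤A s x {∤} Φₛ∣A = toWitnessFalse ∤ (∣ₚ⇒eval-∣ (mask A) (Φ s) x Φₛ∣A)

-- `Φ 2` and `Φ 3` take the values 2 and 3 at 1, both dividing 72, so 1 decides nothing. At 4, `Φ 2`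
-- is 5, and A(4) ≡ A(-1) = 24 - 48 mod 5.
Φ₂∤A : ¬ Φ 2 ∣ₚ mask A
Φ₂∤A = Φ∤A 2 (+ 4)

-- `Φ 3` is 21 at 4. As 4 has order 3 mod 7, the column sums give A(4) ≡ 18 + 18 * 4 + 36 * 2 ≡ 1
-- mod 7.
Φ₃∤A : ¬ Φ 3 ∣ₚ mask A
Φ₃∤A = Φ∤A 3 (+ 4)

Φ∣A : ∀ s → quot (mask A) (Φ s) ⊗ Φ s ≡ mask A → Φ s ∣ₚ mask A
Φ∣A s = exact-quot⇒∣ₚ (mask A) (Φ s)

S⊆S* : All (_∈S* A) S
S⊆S* =
  ((2 , 2 , prime[2] , s≤s z≤n , refl) , from-yes (4 ∣? M)  , Φ∣A 4 refl)  ∷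
  ((2 , 3 , prime[2] , s≤s z≤n , refl) , from-yes (8 ∣? M)  , Φ∣A 8 refl)  ∷
  ((2 , 4 , prime[2] , s≤s z≤n , refl) , from-yes (16 ∣? M) , Φ∣A 16 refl) ∷
  ((3 , 2 , prime[3] , s≤s z≤n , refl) , from-yes (9 ∣? M)  , Φ∣A 9 refl)  ∷
  ((3 , 3 , prime[3] , s≤s z≤n , refl) , from-yes (27 ∣? M) , Φ∣A 27 refl) ∷ []

2^-∈S : ∀ α → 1 ≤ α → α < 5 → Φ (2 ^ α) ∣ₚ mask A → 2 ^ α ∈ S
2^-∈S 1 _ _ Φ₂∣A = contradiction Φ₂∣A Φ₂∤A
2^-∈S 2 _ _ _    = here refl
2^-∈S 3 _ _ _    = there (here refl)
2^-∈S 4 _ _ _    = there (there (here refl))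
2^-∈S (suc (suc (suc (suc (suc _))))) _ (s≤s (s≤s (s≤s (s≤s (s≤s ()))))) _

3^-∈S : ∀ α → 1 ≤ α → α < 4 → Φ (3 ^ α) ∣ₚ mask A → 3 ^ α ∈ S
3^-∈S 1 _ _ Φ₃∣A = contradiction Φ₃∣A Φ₃∤A
3^-∈S 2 _ _ _    = there (there (there (here refl)))
3^-∈S 3 _ _ _    = there (there (there (there (here refl))))
3^-∈S (suc (suc (suc (suc _)))) _ (s≤s (s≤s (s≤s (s≤s ())))) _

S*⊆S : ∀ s → s ∈S* A → s ∈ S
S*⊆S _ ((p , suc α , pp , 1≤α , refl) , s∣M , Φₛ∣A)
  with prime-∣-2ᵃ*3ᵇ 4 3 pp (∣-trans (m∣m*n (p ^ α)) s∣M)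
-- 32 and 81 are the least powers of 2 and 3 not dividing `M`; they bound the exponents by 4 and 3.
... | inj₁ refl = 2^-∈S (suc α) 1≤α (exponent-< 2 5 s∣M (from-no (32 ∣? M))) Φₛ∣A
... | inj₂ refl = 3^-∈S (suc α) 1≤α (exponent-< 3 4 s∣M (from-no (81 ∣? M))) Φₛ∣A

T1-A : T1 A
-- Since Φ at a power of a prime p has value p at 1, the last `refl` amounts to 72 = 2 * 2 * 2 * 3 *
-- 3.
T1-A = S , from-yes (unique? S) , (λ s → mk⇔ (lookup S⊆S*) (S*⊆S s)) , refl
  where open DecUnique _≟_ using (unique?)

two-primes : ExactlyTwoPrimeDivisors M
two-primes = 2 , 3 , prime[2] , prime[3] , (λ ()) , from-yes (2 ∣? M) , from-yes (3 ∣? M) ,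
             λ _ → prime-∣-2ᵃ*3ᵇ 4 3

-- As 6 is squarefree, only exponent 1 survives: 0 is not maximal for a prime dividing 6, and larger
-- ones would make 4 or 9 divide 6.
Φ-prime-part-∤A : ∀ p α → Prime p → p ∣ 6 → p ^ α ∣ 6 → ¬ p ^ suc α ∣ 6 → ¬ Φ (p ^ α) ∣ₚ mask A
Φ-prime-part-∤A p zero pp p∣6 _ p¹∤6 = contradiction (subst (_∣ 6) (sym (*-identityʳ p)) p∣6) p¹∤6
Φ-prime-part-∤A p (suc zero) pp p∣6 _ _ with prime-∣-2ᵃ*3ᵇ 1 1 pp p∣6
... | inj₁ refl = Φ₂∤A
... | inj₂ refl = Φ₃∤A
Φ-prime-part-∤A p (suc (suc α)) pp p∣6 pᵅ∣6 _ with prime-∣-2ᵃ*3ᵇ 1 1 pp p∣6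
... | inj₁ refl = contradiction (exponent-< 2 2 {α = suc (suc α)} pᵅ∣6 (from-no (4 ∣? 6))) λ { (s≤s (s≤s ())) }
... | inj₂ refl = contradiction (exponent-< 3 2 {α = suc (suc α)} pᵅ∣6 (from-no (9 ∣? 6))) λ { (s≤s (s≤s ())) }

Φ₆-unsupported : UnsupportedDivisor A 6
Φ₆-unsupported = record
  { s∣M           = from-yes (6 ∣? M)
  ; s≢1           = λ ()
  ; Φₛ∣A          = Φ∣A 6 refl
  -- `card A` evaluates to 72.
  ; primes-∣-card = λ p _ p∣6 → ∣-trans p∣6 (from-yes (6 ∣? 72))
  ; Φ-∤A          = Φ-prime-part-∤A
  }

theorem1p10 : ∃ λ (M : ℕ) → ∃ λ (A : Subset M) →
    Nonempty A × T1 A × ExactlyTwoPrimeDivisors M × ∃ (UnsupportedDivisor A)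
theorem1p10 = M , A , from-yes (nonempty? A) , T1-A , two-primes , 6 , Φ₆-unsupported
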